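{- Let $k$ be an integer. (1) Any root quadruple $\mathbf a=(a,b,c,d)$ with $Q_{\mathcal D}(\mathbf a)=k$, $a\le b\le c\le d$ and $L(\mathbf a)>0$ satisfies $0\le b\le c\le d$; moreover, if $k>0$ then $a<0$, and if $k\le0$ then $a\le\sqrt{|k|}$. (2) For each pair of integers $(k,-n)$ there are only finitely many root quadruples $\mathbf a=(a,b,c,d)$, $a\le b\le c\le d$, with $Q_{\mathcal D}(\mathbf a)=k$ and $a=-n$, except for the pairs $(k,-n)=(4l^2,-l)$ with $l\ge0$; for each such exceptional pair there is an infinite family of root quadruples $\{(-l,l,c,c):c\ge\max(l,1)\}$.
   Context: $Q_{\mathcal D}(a,b,c,d)=2(a^2+b^2+c^2+d^2)-(a+b+c+d)^2$, $L(\mathbf a)=a+b+c+d$, $|\mathbf a|=|a|+|b|+|c|+|d|$. $\mathbf S_i$ ($i=1,\dots,4$) is the integer matrix replacing the $i$-th coordinate $a_i$ of a quadruple by $2\sum_{j\ne i}a_j-a_i$, other coordinates fixed. An integer quadruple is reduced if no $\mathbf S_i$ strictly decreases $|\cdot|$. A reduced quadruple ordered as $a\le b\le c\le d$ with $L\ge 0$ is a root quadruple if $a+b+c\ge d>0$; a reduced quadruple with $L<0$ is a root quadruple if $(-d,-c,-b,-a)$ is one. -}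

module Defs where

open import Data.Fin.Base using (Fin)
open import Data.Integer.Base using (ℤ; +_; -_; _+_; _-_; _*_; _≤_; _<_; _⊔_; 0ℤ; 1ℤ; ∣_∣)
open import Data.List.Base using (List)
open import Data.List.Membership.Propositional using (_∈_)
open import Data.Nat.Base as ℕ using (ℕ)
open import Data.Product.Base using (∃-syntax; Σ-syntax; _×_)
open import Data.Sum.Base using (_⊎_)
open import Data.Vec.Base as Vec using (Vec; []; _∷_; lookup; removeAt; _[_]≔_)
open import Function.Definitions using (Injective)
open import Relation.Binary.PropositionalEquality.Core using (_≡_)
open import Relation.Nullary.Negation.Core using (¬_)
open import Relation.Unary using (Pred)
open import Level using (0ℓ)

Quad : Set
Quad = Vec ℤ 4

pattern ⟨_,_,_,_⟩ a b c d = a ∷ b ∷ c ∷ d ∷ []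

L : Quad → ℤ
L ⟨ a , b , c , d ⟩ = a + b + c + d

Q : Quad → ℤ
Q ⟨ a , b , c , d ⟩ =
  + 2 * (a * a + b * b + c * c + d * d) - (a + b + c + d) * (a + b + c + d)

∥_∥ : Quad → ℕ
∥ v ∥ = Vec.sum (Vec.map ∣_∣ v)

S : Fin 4 → Quad → Quad
S i v = v [ i ]≔ (+ 2 * Vec.foldr′ _+_ 0ℤ (removeAt v i) - lookup v i)

Reduced : Pred Quad 0ℓ
Reduced v = ∀ i → ¬ (∥ S i v ∥ ℕ.< ∥ v ∥)

Ordered : Pred Quad 0ℓ
Ordered ⟨ a , b , c , d ⟩ = a ≤ b × b ≤ c × c ≤ d

-- The recursion in the second constructor stops after one step, because
-- negating and reversing the quadruple changes the sign of L.
data IsRoot : Pred Quad 0ℓ where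
  L≥0 : ∀ {a b c d} → Reduced ⟨ a , b , c , d ⟩ → Ordered ⟨ a , b , c , d ⟩ →
        0ℤ ≤ L ⟨ a , b , c , d ⟩ → d ≤ a + b + c → 0ℤ < d →
        IsRoot ⟨ a , b , c , d ⟩
  L<0 : ∀ {a b c d} → Reduced ⟨ a , b , c , d ⟩ →
        L ⟨ a , b , c , d ⟩ < 0ℤ → IsRoot ⟨ - d , - c , - b , - a ⟩ →
        IsRoot ⟨ a , b , c , d ⟩

-- a ≤√ m says that a is at most the nonnegative real square root of m.
_≤√_ : ℤ → ℕ → Set
a ≤√ m = a ≤ 0ℤ ⊎ a * a ≤ + m

RootsWith : (k a : ℤ) → Pred Quad 0ℓ
RootsWith k a₀ ⟨ a , b , c , d ⟩ =
  IsRoot ⟨ a , b , c , d ⟩ × Ordered ⟨ a , b , c , d ⟩ ×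
  Q ⟨ a , b , c , d ⟩ ≡ k × a ≡ a₀

Family : ℤ → Pred Quad 0ℓ
Family l v = ∃[ c ] l ⊔ 1ℤ ≤ c × v ≡ ⟨ - l , l , c , c ⟩

FinitelyMany : Pred Quad 0ℓ → Set
FinitelyMany P = Σ[ vs ∈ List Quad ] (∀ v → P v → v ∈ vs)

InfinitelyMany : Pred Quad 0ℓ → Set
InfinitelyMany P = Σ[ f ∈ (ℕ → Quad) ] Injective _≡_ _≡_ f × (∀ m → P (f m))

{-# OPTIONS --safe #-}

-- Put t = a + b and x = a + b + c - d. Ordering and d ≤ a + b + c give
-- 0 ≤ x ≤ t, and Q = x² - 4ab - 4tc. So if a ≥ 0 then Q ≤ - a². If t = 0
-- then x = 0 and Q = 4a², the exceptional case; otherwise t ≥ 1, and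
-- t ≤ a + c makes c at most 4a² - Q - a, so only finitely many
-- quadruples are possible once a and Q are fixed. Roots with L < 0 satisfy
-- a ≤ b ≤ c ≤ d ≤ - a.
module Submission where

open import Defs
open import Data.Empty using (⊥-elim)
open import Data.Fin.Base using (zero; suc)
open import Data.Integer.Base using (ℤ; +_; -_; _*_; _≤_; _<_; 0ℤ; ∣_∣; 1ℤ; _+_; _-_; _⊔_; +≤+; +<+)
open import Data.Integer.Properties
open import Algebra.Properties.AbelianGroup +-0-abelianGroup using (∙-cancelˡ)
open import Data.Integer.Tactic.RingSolver using (solve-∀)
open import Data.List.Base using (List; []; _∷_; map; upTo; cartesianProductWith)
open import Data.List.Membership.Propositional using (_∈_)
open import Data.List.Membership.Propositional.Properties using (∈-map⁺; ∈-upTo⁺; ∈-cartesianProductWith⁺)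
open import Data.List.Relation.Unary.Any using (here)
open import Data.Nat.Base as ℕ using ()
import Data.Nat.Properties as ℕ
open import Data.Product.Base using (∃-syntax; _×_; _,_)
open import Data.Sum.Base using (inj₁; inj₂)
open import Data.Vec.Base using (Vec; []; _∷_)
open import Data.Vec.Properties using (∷-injectiveˡ; ∷-injectiveʳ)
open import Relation.Binary.PropositionalEquality using (refl; sym; trans; cong; cong₂; subst)
open import Relation.Binary.PropositionalEquality.Core using (_≡_)
open import Relation.Nullary.Decidable.Core using (yes; no)
open import Relation.Nullary.Negation.Core using (¬_)
open import Relation.Unary using (_⊆_)

-- Certificates for integer inequalities.

infixl 6 _⊕_
infixl 7 _⊗_

_⊕_ : ∀ {x y} → 0ℤ ≤ x → 0ℤ ≤ y → 0ℤ ≤ x + y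
_⊕_ = +-mono-≤

_⊗_ : ∀ {x y} → 0ℤ ≤ x → 0ℤ ≤ y → 0ℤ ≤ x * y
+≤+ {n = m} _ ⊗ +≤+ {n = n} _ = subst (0ℤ ≤_) (pos-* m n) (+≤+ ℕ.z≤n)

-- Polynomial inequalities are reduced to identities: `z` is a combination of nonnegative quantities
-- built with `_⊕_` and `_⊗_`, and the ring solver checks the difference.
≤-from-diff : ∀ {x y z} → 0ℤ ≤ z → y - x ≡ z → x ≤ y
≤-from-diff 0≤z eq = 0≤i-j⇒j≤i (subst (0ℤ ≤_) (sym eq) 0≤z)

0≤2*i⇒0≤i : ∀ {i} → 0ℤ ≤ + 2 * i → 0ℤ ≤ i
0≤2*i⇒0≤i {i} = *-cancelˡ-≤-pos 0ℤ i (+ 2)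

∣∣-mono-≤ : ∀ {x y} → 0ℤ ≤ x → x ≤ y → ∣ x ∣ ℕ.≤ ∣ y ∣
∣∣-mono-≤ (+≤+ _) (+≤+ x≤y) = x≤y

i≤0⇒+∣i∣≡-i : ∀ {i} → i ≤ 0ℤ → + ∣ i ∣ ≡ - i
i≤0⇒+∣i∣≡-i {i} i≤0 = trans (cong +_ (sym (∣-i∣≡∣i∣ i))) (0≤i⇒+∣i∣≡i (neg-mono-≤ i≤0))

-- Inequalities for ordered quadruples with `d ≤ a + b + c`.

record Bounds (a b c d : ℤ) : Set where
  field
    a≤b   : 0ℤ ≤ b - a
    b≤c   : 0ℤ ≤ c - b
    c≤d   : 0ℤ ≤ d - c
    d≤abc : 0ℤ ≤ a + b + c - d

  0≤a+b : 0ℤ ≤ a + b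
  0≤a+b = subst (0ℤ ≤_) (eq a b c d) (d≤abc ⊕ c≤d)
    where
    eq : ∀ a b c d → a + b + c - d + (d - c) ≡ a + b
    eq = solve-∀

  0≤b : 0ℤ ≤ b
  0≤b = 0≤2*i⇒0≤i (subst (0ℤ ≤_) (eq a b) (a≤b ⊕ 0≤a+b))
    where
    eq : ∀ a b → b - a + (a + b) ≡ + 2 * b
    eq = solve-∀

  0≤c : 0ℤ ≤ c
  0≤c = ≤-trans 0≤b (0≤i-j⇒j≤i b≤c)

  -- Since t - x = d - c, -Q = 4ab + 4tc - t² + (d - c)(t + x). The certificate splits 4ab - a² as
  -- 3a² + 4a(b - a), and 4tc - t² as 2tc + t((b - a) + 2(c - b)).
  a*a≤-Q : 0ℤ ≤ a → a * a ≤ - Q ⟨ a , b , c , d ⟩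
  a*a≤-Q 0≤a = ≤-from-diff
    (+≤+ {n = 3} ℕ.z≤n ⊗ (0≤a ⊗ 0≤a) ⊕ +≤+ {n = 4} ℕ.z≤n ⊗ (0≤a ⊗ a≤b)
      ⊕ +≤+ {n = 2} ℕ.z≤n ⊗ (0≤a+b ⊗ 0≤c) ⊕ 0≤a+b ⊗ (a≤b ⊕ b≤c ⊕ b≤c)
      ⊕ c≤d ⊗ (0≤a+b ⊕ d≤abc))
    (eq a b c d)
    where
    eq : ∀ a b c d →
         - (+ 2 * (a * a + b * b + c * c + d * d) - (a + b + c + d) * (a + b + c + d)) - a * a
         ≡ + 3 * (a * a) + + 4 * (a * (b - a)) + + 2 * ((a + b) * c)
           + (a + b) * (b - a + (c - b) + (c - b)) + (d - c) * (a + b + (a + b + c - d))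
    eq = solve-∀

  -- The doubled bracket of the certificate equals 4a² - Q - a - c. It is nonnegative because a + c
  -- = t + (c - b) is at most t(a + c) when t ≥ 1. The last two terms encode d ≤ a + b + c ≤ a + 2c,
  -- which turns the bound on c into one on d.
  d-bound : 1ℤ ≤ a + b → d ≤ + 8 * (a * a) - + 2 * Q ⟨ a , b , c , d ⟩ - a
  d-bound 1≤a+b = ≤-from-diff
    (+≤+ {n = 2} ℕ.z≤n
      ⊗ (i≤j⇒0≤j-i 1≤a+b ⊗ (0≤a+b ⊕ b≤c) ⊕ +≤+ {n = 2} ℕ.z≤n ⊗ (0≤a+b ⊗ (0≤a+b ⊕ b≤c))
         ⊕ 0≤a+b ⊗ b≤c ⊕ c≤d ⊗ (0≤a+b ⊕ d≤abc))
      ⊕ d≤abc ⊕ b≤c)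
    (eq a b c d)
    where
    eq : ∀ a b c d →
         + 8 * (a * a) - + 2 * (+ 2 * (a * a + b * b + c * c + d * d) - (a + b + c + d) * (a + b + c + d)) - a - d
         ≡ + 2 * ((a + b - 1ℤ) * (a + b + (c - b)) + + 2 * ((a + b) * (a + b + (c - b)))
           + (a + b) * (c - b) + (d - c) * (a + b + (a + b + c - d)))
           + (a + b + c - d) + (c - b)
    eq = solve-∀

  -- Here c ≤ d ≤ a + b + c forces c = d.
  Q-exceptional : a + b ≡ 0ℤ → 0ℤ ≤ - a × Q ⟨ a , b , c , d ⟩ ≡ + 4 * (- a * - a)
  Q-exceptional a+b≡0 =
    0≤2*i⇒0≤i (subst (0ℤ ≤_) (trans (eq₁ a b) (trans (cong (λ t → - (+ 2 * a) + t) a+b≡0) (eq₂ a))) a≤b) ,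
    trans (eq₃ a b c d) (trans (cong₂ (λ t x → x * x + + 4 * (- a * - a) - + 4 * (t * (a + c))) a+b≡0 x≡0) (eq₄ a c))
    where
    eq₁ : ∀ a b → b - a ≡ - (+ 2 * a) + (a + b)
    eq₁ = solve-∀
    eq₂ : ∀ a → - (+ 2 * a) + 0ℤ ≡ + 2 * - a
    eq₂ = solve-∀
    eq₃ : ∀ a b c d →
          + 2 * (a * a + b * b + c * c + d * d) - (a + b + c + d) * (a + b + c + d)
          ≡ (a + b + c - d) * (a + b + c - d) + + 4 * (- a * - a) - + 4 * ((a + b) * (a + c))
    eq₃ = solve-∀
    eq₄ : ∀ a c → 0ℤ * 0ℤ + + 4 * (- a * - a) - + 4 * (0ℤ * (a + c)) ≡ + 4 * (- a * - a)
    eq₄ = solve-∀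
    eq₅ : ∀ a b c d → a + b - (a + b + c - d) ≡ d - c
    eq₅ = solve-∀
    x≡0 : a + b + c - d ≡ 0ℤ
    x≡0 = ≤-antisym (subst (a + b + c - d ≤_) a+b≡0 (≤-from-diff c≤d (eq₅ a b c d))) d≤abc

bounds : ∀ {a b c d} → Ordered ⟨ a , b , c , d ⟩ → d ≤ a + b + c → Bounds a b c d
bounds (a≤b , b≤c , c≤d) d≤abc = record
  { a≤b = i≤j⇒0≤j-i a≤b ; b≤c = i≤j⇒0≤j-i b≤c ; c≤d = i≤j⇒0≤j-i c≤d ; d≤abc = i≤j⇒0≤j-i d≤abc }

L-neg-reverse : ∀ a b c d → L ⟨ - d , - c , - b , - a ⟩ ≡ - L ⟨ a , b , c , d ⟩
L-neg-reverse = eq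
  where
  eq : ∀ a b c d → - d + - c + - b + - a ≡ - (a + b + c + d)
  eq = solve-∀

L≥0⇒bounds : ∀ {a b c d} → IsRoot ⟨ a , b , c , d ⟩ → 0ℤ ≤ L ⟨ a , b , c , d ⟩ → Bounds a b c d
L≥0⇒bounds (L≥0 _ ord _ d≤abc _) _   = bounds ord d≤abc
L≥0⇒bounds (L<0 _ L<0′ _)        0≤L = ⊥-elim (<⇒≱ L<0′ 0≤L)

-- The two least entries of the reflected root have nonnegative sum, so c + d ≤ 0 and hence d ≤ -c ≤
-- -a.
L<0⇒d≤-a : ∀ {a b c d} → IsRoot ⟨ - d , - c , - b , - a ⟩ →
            Ordered ⟨ a , b , c , d ⟩ → L ⟨ a , b , c , d ⟩ < 0ℤ → d ≤ - a
L<0⇒d≤-a {a} {b} {c} {d} root (a≤b , b≤c , _) L<0′ =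
  ≤-from-diff (0≤a+b ⊕ i≤j⇒0≤j-i a≤b ⊕ i≤j⇒0≤j-i b≤c) (eq a b c d)
  where
  open Bounds (L≥0⇒bounds root (subst (0ℤ ≤_) (sym (L-neg-reverse a b c d)) (neg-mono-≤ (<⇒≤ L<0′)))) using (0≤a+b)
  eq : ∀ a b c d → - a - d ≡ - d + - c + (b - a) + (c - b)
  eq = solve-∀

interval : ℤ → ℤ → List ℤ
-- `upTo` excludes its end, so `suc` is what includes `j`.
interval i j = map (λ m → i + + m) (upTo (ℕ.suc ∣ j - i ∣))

∈-interval : ∀ {i j x} → i ≤ x → x ≤ j → x ∈ interval i j
∈-interval {i} {j} {x} i≤x x≤j =
  subst (_∈ interval i j) (trans (cong (λ y → i + y) (0≤i⇒+∣i∣≡i 0≤x-i)) (eq i x))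
    (∈-map⁺ (λ m → i + + m) (∈-upTo⁺ (ℕ.s≤s (∣∣-mono-≤ 0≤x-i (+-monoˡ-≤ (- i) x≤j)))))
  where
  0≤x-i : 0ℤ ≤ x - i
  0≤x-i = i≤j⇒0≤j-i i≤x
  eq : ∀ i x → i + (x - i) ≡ x
  eq = solve-∀

box : ℤ → ℤ → List Quad
box i j = r (r (r (r ([] ∷ []))))
  where
  r : ∀ {n} → List (Vec ℤ n) → List (Vec ℤ (ℕ.suc n))
  r = cartesianProductWith _∷_ (interval i j)

∈-box : ∀ {a b c d j} → Ordered ⟨ a , b , c , d ⟩ → d ≤ j → ⟨ a , b , c , d ⟩ ∈ box a j
∈-box (a≤b , b≤c , c≤d) d≤j =
  cons ≤-refl (≤-trans a≤b (≤-trans b≤c c≤j))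
    (cons a≤b (≤-trans b≤c c≤j) (cons (≤-trans a≤b b≤c) c≤j
      (cons (≤-trans a≤b (≤-trans b≤c c≤d)) d≤j (here refl))))
  where
  c≤j = ≤-trans c≤d d≤j
  cons : ∀ {i j x n} {v : Vec ℤ n} {vs} → i ≤ x → x ≤ j → v ∈ vs →
         (x ∷ v) ∈ cartesianProductWith _∷_ (interval i j) vs
  cons i≤x x≤j = ∈-cartesianProductWith⁺ _∷_ (∈-interval i≤x x≤j)

Exceptional : ℤ → ℤ → Set
Exceptional k a = ∃[ l ] 0ℤ ≤ l × (k , a) ≡ (+ 4 * (l * l) , - l)

-- The left argument of the maximum bounds the roots with L ≥ 0, the right one those with L < 0.
upper : ℤ → ℤ → ℤ
upper k a = (+ 8 * (a * a) - + 2 * k - a) ⊔ - a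

-- For L ≥ 0, a vanishing `a + b` would make the pair exceptional with l = -a; otherwise integrality
-- gives a + b ≥ 1, as `d-bound` requires.
root-≤-upper : ∀ {a b c d} → IsRoot ⟨ a , b , c , d ⟩ → Ordered ⟨ a , b , c , d ⟩ →
               ¬ Exceptional (Q ⟨ a , b , c , d ⟩) a → d ≤ upper (Q ⟨ a , b , c , d ⟩) a
root-≤-upper {a} {b} {c} {d} (L≥0 _ ord _ d≤abc _) _ ¬exc with 0ℤ ≟ a + b
... | yes 0≡a+b =
  let 0≤-a , Q≡ = Q-exceptional (sym 0≡a+b)
  in ⊥-elim (¬exc (- a , 0≤-a , cong₂ _,_ Q≡ (sym (neg-involutive a))))
  where open Bounds (bounds {a} {b} {c} {d} ord d≤abc)
... | no 0≢a+b = ≤-trans (d-bound (i<j⇒suc[i]≤j (≤∧≢⇒< 0≤a+b 0≢a+b))) (i≤i⊔j _ (- a))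
  where open Bounds (bounds {a} {b} {c} {d} ord d≤abc)
root-≤-upper {a} (L<0 _ L<0′ root) ord _ =
  ≤-trans (L<0⇒d≤-a root ord L<0′) (i≤j⊔i _ (- a))

-- The list has only to cover the roots, so the full box from the least entry `a` to the bound on
-- `d` serves.
finitelyMany-roots : ∀ {k a} → ¬ Exceptional k a → FinitelyMany (RootsWith k a)
finitelyMany-roots {k} {a} ¬exc = box a (upper k a) , λ where
  ⟨ _ , b , c , d ⟩ (root , ord , refl , refl) → ∈-box ord (root-≤-upper root ord ¬exc)

-- The exceptional family.

module _ {l c : ℤ} (0≤l : 0ℤ ≤ l) (l≤c : l ≤ c) (0<c : 0ℤ < c) where

  private
    0≤c : 0ℤ ≤ c
    0≤c = <⇒≤ 0<c

    0≤c-l : 0ℤ ≤ c - l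
    0≤c-l = i≤j⇒0≤j-i l≤c

  family-ordered : Ordered ⟨ - l , l , c , c ⟩
  family-ordered = ≤-trans (neg-mono-≤ 0≤l) 0≤l , l≤c , ≤-refl

  -- The first entry becomes 3l + 4c and the second 4c - 3l, both at least l because 0 ≤ l ≤ c; the
  -- last two entries are fixed.
  family-reduced : Reduced ⟨ - l , l , c , c ⟩
  family-reduced zero = ℕ.≤⇒≯ (ℕ.+-monoˡ-≤ _ (ℕ.≤-trans (ℕ.≤-reflexive (∣-i∣≡∣i∣ l)) (∣∣-mono-≤ 0≤l l≤)))
    where
    eq : ∀ l c → + 2 * (l + (c + (c + 0ℤ))) - - l - l ≡ + 2 * l + + 4 * c
    eq = solve-∀
    l≤ : l ≤ + 2 * (l + (c + (c + 0ℤ))) - - l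
    l≤ = ≤-from-diff (+≤+ {n = 2} ℕ.z≤n ⊗ 0≤l ⊕ +≤+ {n = 4} ℕ.z≤n ⊗ 0≤c) (eq l c)
  family-reduced (suc zero) = ℕ.≤⇒≯ (ℕ.+-monoʳ-≤ ∣ - l ∣ (ℕ.+-monoˡ-≤ _ (∣∣-mono-≤ 0≤l l≤)))
    where
    eq : ∀ l c → + 2 * (- l + (c + (c + 0ℤ))) - l - l ≡ + 4 * (c - l)
    eq = solve-∀
    l≤ : l ≤ + 2 * (- l + (c + (c + 0ℤ))) - l
    l≤ = ≤-from-diff (+≤+ {n = 4} ℕ.z≤n ⊗ 0≤c-l) (eq l c)
  family-reduced (suc (suc i)) = fixed i
    where
    eq : ∀ l c → + 2 * (- l + (l + (c + 0ℤ))) - c ≡ c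
    eq = solve-∀
    fixed : ∀ i → ¬ (∥ S (suc (suc i)) ⟨ - l , l , c , c ⟩ ∥ ℕ.< ∥ ⟨ - l , l , c , c ⟩ ∥)
    fixed zero       = ℕ.<-irrefl (cong (λ x → ∥ ⟨ - l , l , x , c ⟩ ∥) (eq l c))
    fixed (suc zero) = ℕ.<-irrefl (cong (λ x → ∥ ⟨ - l , l , c , x ⟩ ∥) (eq l c))

  family-root : IsRoot ⟨ - l , l , c , c ⟩
  family-root = L≥0 family-reduced family-ordered
    (subst (0ℤ ≤_) (eq₁ l c) (0≤c ⊕ 0≤c)) (≤-reflexive (eq₂ l c)) 0<c
    where
    eq₁ : ∀ l c → c + c ≡ - l + l + c + c
    eq₁ = solve-∀
    eq₂ : ∀ l c → c ≡ - l + l + c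
    eq₂ = solve-∀

family-Q : ∀ l c → Q ⟨ - l , l , c , c ⟩ ≡ + 4 * (l * l)
family-Q = eq
  where
  eq : ∀ l c → + 2 * (- l * - l + l * l + c * c + c * c) - (- l + l + c + c) * (- l + l + c + c) ≡ + 4 * (l * l)
  eq = solve-∀

family⊆roots : ∀ {l} → 0ℤ ≤ l → Family l ⊆ RootsWith (+ 4 * (l * l)) (- l)
family⊆roots {l} 0≤l (c , l⊔1≤c , refl) =
  family-root 0≤l l≤c 0<c , family-ordered 0≤l l≤c 0<c , family-Q l c , refl
  where
  l≤c : l ≤ c
  l≤c = ≤-trans (i≤i⊔j l 1ℤ) l⊔1≤c
  -- The 1 in the maximum matters for l = 0, where l ≤ c alone would admit c = 0.
  0<c : 0ℤ < c
  0<c = <-≤-trans (+<+ (ℕ.s≤s ℕ.z≤n)) (≤-trans (i≤j⊔i l 1ℤ) l⊔1≤c)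

family-infinite : ∀ l → InfinitelyMany (Family l)
family-infinite l =
  (λ m → ⟨ - l , l , l ⊔ 1ℤ + + m , l ⊔ 1ℤ + + m ⟩) ,
  -- The third coordinate recovers the index.
  (λ eq → +-injective (∙-cancelˡ (l ⊔ 1ℤ) _ _ (∷-injectiveˡ (∷-injectiveʳ (∷-injectiveʳ eq))))) ,
  (λ m → _ , i≤i+j (l ⊔ 1ℤ) (+ m) , refl)

theorem3p3 : (k : ℤ) →
    (∀ a b c d → IsRoot ⟨ a , b , c , d ⟩ → Q ⟨ a , b , c , d ⟩ ≡ k →
    a ≤ b → b ≤ c → c ≤ d → 0ℤ < L ⟨ a , b , c , d ⟩ →
    (0ℤ ≤ b × b ≤ c × c ≤ d) ×
    (0ℤ < k → a < 0ℤ) ×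
    (k ≤ 0ℤ → a ≤√ ∣ k ∣))
    ×
    (∀ n →
    (¬ (∃[ l ] 0ℤ ≤ l × (k , - n) ≡ (+ 4 * (l * l) , - l)) →
    FinitelyMany (RootsWith k (- n))) ×
    (∀ l → 0ℤ ≤ l → (k , - n) ≡ (+ 4 * (l * l) , - l) →
    Family l ⊆ RootsWith k (- n) × InfinitelyMany (Family l)))
theorem3p3 k = part₁ , part₂
  where
  part₁ : ∀ a b c d → IsRoot ⟨ a , b , c , d ⟩ → Q ⟨ a , b , c , d ⟩ ≡ k →
          a ≤ b → b ≤ c → c ≤ d → 0ℤ < L ⟨ a , b , c , d ⟩ →
          (0ℤ ≤ b × b ≤ c × c ≤ d) × (0ℤ < k → a < 0ℤ) × (k ≤ 0ℤ → a ≤√ ∣ k ∣)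
  part₁ a b c d root refl _ b≤c′ c≤d′ 0<L = (0≤b , b≤c′ , c≤d′) , negative , bounded
    where
    open Bounds (L≥0⇒bounds root (<⇒≤ 0<L))
    negative : 0ℤ < k → a < 0ℤ
    -- If a ≥ 0, then 0 ≤ a² ≤ -k, which contradicts k > 0.
    negative 0<k = ≰⇒> λ 0≤a → <⇒≱ (neg-mono-< 0<k) (≤-trans (0≤a ⊗ 0≤a) (a*a≤-Q 0≤a))
    bounded : k ≤ 0ℤ → a ≤√ ∣ k ∣
    bounded k≤0 with ≤-total a 0ℤ
    ... | inj₁ a≤0 = inj₁ a≤0
    ... | inj₂ 0≤a = inj₂ (subst (a * a ≤_) (sym (i≤0⇒+∣i∣≡-i k≤0)) (a*a≤-Q 0≤a))

  part₂ : ∀ n →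
          (¬ Exceptional k (- n) → FinitelyMany (RootsWith k (- n))) ×
          (∀ l → 0ℤ ≤ l → (k , - n) ≡ (+ 4 * (l * l) , - l) →
            Family l ⊆ RootsWith k (- n) × InfinitelyMany (Family l))
  part₂ n = finitelyMany-roots , λ l 0≤l eq →
    (λ {v} v∈F → subst (λ (k , a) → RootsWith k a v) (sym eq) (family⊆roots 0≤l v∈F)) ,
    family-infinite l
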